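{- Let $n\ge 1$ and $d\geq 3$ be integers. Then the graph $\mathcal{M}_{n,d}$ is connected. Equivalently, any time-homogeneous Markov chain on $\mathcal{G}_{n,d}$ whose transition matrix $P$ satisfies $P(G,G')>0$ if and only if $G'$ can be obtained from $G$ by a single $\Delta$-switch is irreducible on $\mathcal{G}_{n,d}$.
   Context: All graphs are simple. $\mathcal{G}_{n,d}$ denotes the set of all $d$-regular graphs with vertex set $[n]=\{1,\dots,n\}$. A $\Delta^+$-switch in a graph $G=(V,E)$: if $v,x,y,w,z$ are distinct vertices such that $yx, xv, vw, wz\in E$ and $xw, yz\notin E$, delete the edges $xy$, $wz$ and insert the edges $xw$, $yz$ (creating a triangle on $v,x,w$). A $\Delta^-$-switch is the reverse operation: if $v,x,y,w,z$ are distinct, $G$ contains the triangle on $v,x,w$ and the edge $yz$, and $xy, wz\notin E$, delete $xw$, $yz$ and insert $xy$, $wz$. A $\Delta$-switch is a $\Delta^+$-switch or a $\Delta^-$-switch; it preserves all vertex degrees. $\mathcal{M}_{n,d}$ is the graph with vertex set $\mathcal{G}_{n,d}$ in which $\{G,G'\}$ is an edge if and only if $G'$ can be obtained from $G$ by a single $\Delta$-switch. -}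

module Defs where

open import Data.Nat using (ℕ)
open import Data.Fin using (Fin)
open import Data.Fin.Properties using () renaming (_≟_ to _≟ᶠ_)
open import Data.Bool using (Bool; true; false; T; _∧_; _∨_; not)
open import Data.List using (List; length; filterᵇ; allFin)
open import Data.Product using (Σ; ∃; _×_; _,_)
open import Data.Sum using (_⊎_)
open import Relation.Nullary using (¬_; does)
open import Relation.Binary.PropositionalEquality using (_≡_)
open import Relation.Binary.Construct.Closure.ReflexiveTransitive using (Star)

record Graph (n : ℕ) : Set where
  field
    adj   : Fin n → Fin n → Bool
    sym   : ∀ i j → adj i j ≡ adj j i
    irrefl : ∀ i → adj i i ≡ false
open Graph public

Edge : ∀ {n} → Graph n → Fin n → Fin n → Set
Edge G i j = adj G i j ≡ true

degree : ∀ {n} → Graph n → Fin n → ℕ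
degree {n} G i = length (filterᵇ (adj G i) (allFin n))

Regular : ∀ {n} → ℕ → Graph n → Set
Regular d G = ∀ i → degree G i ≡ d

_≟ᶠᵇ_ : ∀ {n} → Fin n → Fin n → Bool
a ≟ᶠᵇ b = does (a ≟ᶠ b)

samePair : ∀ {n} → Fin n → Fin n → Fin n → Fin n → Bool
samePair a b p q = ((a ≟ᶠᵇ p) ∧ (b ≟ᶠᵇ q)) ∨ ((a ≟ᶠᵇ q) ∧ (b ≟ᶠᵇ p))

Distinct5 : ∀ {n} → Fin n → Fin n → Fin n → Fin n → Fin n → Set
Distinct5 v x y w z =
  ¬ v ≡ x × ¬ v ≡ y × ¬ v ≡ w × ¬ v ≡ z ×
  ¬ x ≡ y × ¬ x ≡ w × ¬ x ≡ z ×
  ¬ y ≡ w × ¬ y ≡ z ×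
  ¬ w ≡ z

Rewired : ∀ {n} → Graph n → Graph n →
          (a b c d e f g h : Fin n) → Set
Rewired G G' a b c d e f g h =
  ∀ i j → adj G' i j ≡
    ((adj G i j ∧ not (samePair i j a b) ∧ not (samePair i j c d))
      ∨ samePair i j e f ∨ samePair i j g h)

ΔPlus : ∀ {n} → Graph n → Graph n → Set
ΔPlus {n} G G' = Σ (Fin n) λ v → Σ (Fin n) λ x → Σ (Fin n) λ y →
  Σ (Fin n) λ w → Σ (Fin n) λ z →
    Distinct5 v x y w z ×
    Edge G y x × Edge G x v × Edge G v w × Edge G w z ×
    ¬ Edge G x w × ¬ Edge G y z ×
    Rewired G G' x y w z x w y z

ΔMinus : ∀ {n} → Graph n → Graph n → Set
ΔMinus {n} G G' = Σ (Fin n) λ v → Σ (Fin n) λ x → Σ (Fin n) λ y →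
  Σ (Fin n) λ w → Σ (Fin n) λ z →
    Distinct5 v x y w z ×
    Edge G v x × Edge G x w × Edge G w v × Edge G y z ×
    ¬ Edge G x y × ¬ Edge G w z ×
    Rewired G G' x w y z x y w z

ΔSwitch : ∀ {n} → Graph n → Graph n → Set
ΔSwitch G G' = ΔPlus G G' ⊎ ΔMinus G G'

MStep : ∀ {n} → ℕ → Graph n → Graph n → Set
MStep d G G' = Regular d G × Regular d G' × ΔSwitch G G'

-- Connected in M_{n,d}: a path of M-edges (graphs are identified when they
-- have the same adjacency function, i.e. the same edge set).
SameGraph : ∀ {n} → Graph n → Graph n → Set
SameGraph G H = ∀ i j → adj G i j ≡ adj H i j

Reachable : ∀ {n} → ℕ → Graph n → Graph n → Set
Reachable d G H = ∃ λ H' → Star (MStep d) G H' × SameGraph H' H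

MConnected : ℕ → ℕ → Set
MConnected n d = ∀ (G H : Graph n) → Regular d G → Regular d H → Reachable d G H

{-# OPTIONS --safe #-}
-- A general switch removes edges pq, rs and inserts non-edges pr, qs.  Switches connect the d-regular
-- graphs: two graphs are made to agree on one vertex after another, by switches in either of them.
--
-- Every switch is a product of at most four Δ-switches when d ≥ 3.  Generically, let a, b be the further
-- neighbours of p and let a–a′, b–b′ be edges.  A Δ⁺-switch on a′–a–p–b–b′ creates the triangle pab; the
-- triangle edge pb is exchanged with rs by a Δ⁻-switch, which inserts pr and bs; a Δ⁺-switch on the path
-- q–p–a–b–s then restores the triangle and inserts qs; finally the first move is undone.  When the vertices
-- involved coincide or are adjacent, other short sequences work.  The case distinction is a game against the
-- graph: one may ask whether two named vertices are adjacent, or name a new neighbour of a vertex with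
-- fewer than three named neighbours.  A winning strategy is checked by evaluation.
module Submission where

open import Defs
open import Data.Nat using (ℕ; zero; suc; _+_; _*_; _≤_; _<_; z≤n; s≤s; _≡ᵇ_)
open import Data.Nat.Properties hiding (suc-injective)
open import Data.Nat.Tactic.RingSolver using (solve-∀)
open import Data.Fin using (Fin; zero; suc; toℕ; fromℕ<)
open import Data.Fin.Properties using (any?; toℕ<n; toℕ-injective; toℕ-fromℕ<; suc-injective)
  renaming (_≟_ to _≟ᶠ_)
open import Data.Bool using (Bool; true; false; T; not; _∧_; _∨_; _xor_; if_then_else_)
import Data.Bool.Properties as Bool
open import Data.Maybe using (Maybe; just; nothing)
import Data.Maybe.Properties as Maybe
open import Data.List using (List; []; _∷_; length; map; filter; filterᵇ; tabulate; upTo)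
open import Data.List.Membership.Propositional using (_∈_; _∉_)
open import Data.List.Membership.Propositional.Properties using (∈-filter⁺; ∈-upTo⁺; ∈-map⁺)
open import Data.List.Properties using (length-map)
open import Data.List.Relation.Unary.Any using (here; there)
open import Data.Product using (∃; ∃₂; _×_; _,_; proj₁; proj₂)
open import Data.Sum using (_⊎_; inj₁; inj₂)
open import Function using (_∘_; _$_; id; case_of_)
open import Relation.Nullary using (¬_; Dec; yes; no; does; contradiction)
open import Relation.Nullary.Decidable using (dec-true; dec-false; _×-dec_; _⊎-dec_; ¬?; toWitness)
open import Relation.Binary.Construct.Closure.ReflexiveTransitive using (ε; _◅_; _◅◅_)
open import Relation.Binary.PropositionalEquality
  using (_≡_; _≢_; refl; trans; cong; cong₂; subst; module ≡-Reasoning) renaming (sym to ≡-sym)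

private variable
  n d : ℕ

true≢false : ∀ {b} → b ≡ true → b ≢ false
true≢false refl ()

-- Counting vertices by a Boolean predicate.

bit : Bool → ℕ
bit b = if b then 1 else 0

# : (Fin n → Bool) → ℕ
# {zero}  P = 0
# {suc _} P = bit (P zero) + # (P ∘ suc)

length-filter-tabulate : ∀ {m} (P : Fin n → Bool) (g : Fin m → Fin n) →
                         length (filterᵇ P (tabulate g)) ≡ # (P ∘ g)
length-filter-tabulate {m = zero}  P g = refl
length-filter-tabulate {m = suc m} P g with P (g zero)
... | true  = cong suc (length-filter-tabulate P (g ∘ suc))
... | false = length-filter-tabulate P (g ∘ suc)

degree≡# : (G : Graph n) → ∀ i → degree G i ≡ # (adj G i)
degree≡# G i = length-filter-tabulate (adj G i) id

#-cong : {P Q : Fin n → Bool} → (∀ j → P j ≡ Q j) → # P ≡ # Q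
#-cong {zero}  P≗Q = refl
#-cong {suc _} P≗Q = cong₂ _+_ (cong bit (P≗Q zero)) (#-cong (P≗Q ∘ suc))

-- Either side is the count away from `t` plus both bits at `t`; adding the bits crosswise avoids
-- subtraction.
#-update : {P Q : Fin n → Bool} (t : Fin n) → (∀ j → j ≢ t → P j ≡ Q j) →
           # P + bit (Q t) ≡ # Q + bit (P t)
#-update {P = P} {Q} zero P≗Q
  rewrite #-cong {P = P ∘ suc} {Q ∘ suc} (λ j → P≗Q (suc j) λ ()) =
  swap (bit (P zero)) (# (Q ∘ suc)) (bit (Q zero))
  where
  swap : ∀ p s q → (p + s) + q ≡ (q + s) + p
  swap = solve-∀
#-update {P = P} {Q} (suc t) P≗Q
  rewrite P≗Q zero (λ ())
        | +-assoc (bit (Q zero)) (# (P ∘ suc)) (bit (Q (suc t)))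
        | +-assoc (bit (Q zero)) (# (Q ∘ suc)) (bit (P (suc t))) =
  cong (bit (Q zero) +_) (#-update t λ j j≢t → P≗Q (suc j) (j≢t ∘ suc-injective))

#-mono : {P Q : Fin n → Bool} → (∀ j → P j ≡ true → Q j ≡ true) → # P ≤ # Q
#-mono {zero} P⊆Q = z≤n
#-mono {suc _} {P} {Q} P⊆Q = +-mono-≤ (bit-mono (P zero) (Q zero) (P⊆Q zero)) (#-mono (P⊆Q ∘ suc))
  where
  bit-mono : ∀ a b → (a ≡ true → b ≡ true) → bit a ≤ bit b
  bit-mono false _     _   = z≤n
  bit-mono true  true  _   = ≤-refl
  bit-mono true  false a⇒b = contradiction (a⇒b refl) λ ()

_∖_ : (Fin n → Bool) → Fin n → Fin n → Bool
(P ∖ t) j = P j ∧ not (j ≟ᶠᵇ t)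

∖-⊆ : ∀ {P : Fin n → Bool} {t j} → (P ∖ t) j ≡ true → P j ≡ true × j ≢ t
∖-⊆ {P = P} {t} {j} e with P j | j ≟ᶠ t
... | true | no j≢t = refl , j≢t

∖-≢ : ∀ (P : Fin n → Bool) {t j} → j ≢ t → (P ∖ t) j ≡ P j
∖-≢ P {t} {j} j≢t rewrite dec-false (j ≟ᶠ t) j≢t = Bool.∧-identityʳ (P j)

#-∖ : ∀ (P : Fin n → Bool) t → # (P ∖ t) + bit (P t) ≡ # P
#-∖ P t = trans (#-update t λ j → ∖-≢ P) (trans (cong (λ b → # P + bit b) t∉) (+-identityʳ _))
  where
  t∉ : (P ∖ t) t ≡ false
  t∉ rewrite dec-true (t ≟ᶠ t) refl = Bool.∧-zeroʳ (P t)

#-strict : {P Q : Fin n → Bool} → (∀ j → P j ≡ true → Q j ≡ true) →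
           ∀ a → P a ≡ false → Q a ≡ true → # P < # Q
#-strict {P = P} {Q} P⊆Q a Pa Qa = begin-strict
  # P                    ≤⟨ #-mono P⊆Q∖a ⟩
  # (Q ∖ a)              <⟨ n<1+n _ ⟩
  suc (# (Q ∖ a))        ≡⟨ +-comm 1 _ ⟩
  # (Q ∖ a) + 1          ≡⟨ cong (λ b → # (Q ∖ a) + bit b) (≡-sym Qa) ⟩
  # (Q ∖ a) + bit (Q a)  ≡⟨ #-∖ Q a ⟩
  # Q                    ∎
  where
  open ≤-Reasoning
  P⊆Q∖a : ∀ j → P j ≡ true → (Q ∖ a) j ≡ true
  P⊆Q∖a j Pj = trans (∖-≢ Q λ { refl → true≢false Pj Pa }) (P⊆Q j Pj)

-- Otherwise `Q` would lie inside `P` and miss `a`, hence have the smaller count.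
#-exchange : {P Q : Fin n → Bool} → # P ≤ # Q → ∀ a → P a ≡ true → Q a ≡ false →
             ∃ λ b → Q b ≡ true × P b ≡ false
#-exchange {P = P} {Q} P≤Q a Pa Qa
  with any? (λ b → (Q b Bool.≟ true) ×-dec (P b Bool.≟ false))
... | yes found = found
... | no none = contradiction P≤Q (<⇒≱ (#-strict Q⊆P a Qa Pa))
  where
  Q⊆P : ∀ j → Q j ≡ true → P j ≡ true
  Q⊆P j Qj = Bool.¬-not λ Pj → none (j , Qj , Pj)

-- Each entry of `L` takes at most one vertex away from `P`. This supplies the new neighbours that a
-- strategy names.
#-outside : ∀ (P : Fin n → Bool) L → length L < # P → ∃ λ j → P j ≡ true × j ∉ L
#-outside P [] 0<#P with any? (λ j → P j Bool.≟ true)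
... | yes (j , Pj) = j , Pj , λ ()
... | no none = contradiction 0<#P (≤⇒≯ (#-empty P λ j → Bool.¬-not (none ∘ (j ,_))))
  where
  #-empty : ∀ {n} (P : Fin n → Bool) → (∀ j → P j ≡ false) → # P ≤ 0
  #-empty {zero}  P P≗f = z≤n
  #-empty {suc _} P P≗f rewrite P≗f zero = #-empty (P ∘ suc) (P≗f ∘ suc)
#-outside P (t ∷ L) L<#P 
  with #-outside (P ∖ t) L
         (≤-pred (≤-trans L<#P (≤-trans (≤-reflexive (≡-sym (#-∖ P t))) (bit≤ (P t)))))
  where
  bit≤ : ∀ b → # (P ∖ t) + bit b ≤ suc (# (P ∖ t))
  bit≤ true  = ≤-reflexive (+-comm _ 1)
  bit≤ false = ≤-trans (≤-reflexive (+-identityʳ _)) (n≤1+n _)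
... | j , Pj , j∉L with ∖-⊆ {P = P} Pj
... | Pj′ , j≢t = j , Pj′ , λ { (here j≡t) → j≢t j≡t ; (there j∈L) → j∉L j∈L }

#-split : (P U : Fin n → Bool) → # P ≡ # (λ j → P j ∧ U j) + # (λ j → P j ∧ not (U j))
#-split {zero}  P U = refl
#-split {suc _} P U
  rewrite #-split (P ∘ suc) (U ∘ suc) with P zero | U zero
... | true  | true  = refl
... | true  | false = ≡-sym (+-suc _ _)
... | false | _     = refl

-- Vertex pairs, and changing the adjacency of one pair.

≟ᶠᵇ-refl : ∀ (i : Fin n) → (i ≟ᶠᵇ i) ≡ true
≟ᶠᵇ-refl i = dec-true (i ≟ᶠ i) refl

samePair-sym : ∀ (i j a b : Fin n) → samePair i j a b ≡ samePair j i a b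
samePair-sym i j a b = trans (Bool.∨-comm ((i ≟ᶠᵇ a) ∧ (j ≟ᶠᵇ b)) _)
  (cong₂ _∨_ (Bool.∧-comm (i ≟ᶠᵇ b) _) (Bool.∧-comm (i ≟ᶠᵇ a) _))

samePair-true : ∀ {i j a b : Fin n} → samePair i j a b ≡ true →
                (i ≡ a × j ≡ b) ⊎ (i ≡ b × j ≡ a)
samePair-true {i = i} {j} {a} {b} e with i ≟ᶠ a | j ≟ᶠ b | i ≟ᶠ b | j ≟ᶠ a
... | yes i≡a | yes j≡b | _       | _       = inj₁ (i≡a , j≡b)
... | no _    | _       | yes i≡b | yes j≡a = inj₂ (i≡b , j≡a)
... | yes _   | no _    | yes i≡b | yes j≡a = inj₂ (i≡b , j≡a)
samePair-true () | yes _ | no _ | yes _ | no _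
samePair-true () | yes _ | no _ | no _  | _
samePair-true () | no _  | _    | yes _ | no _
samePair-true () | no _  | _    | no _  | _

samePair-irrefl : ∀ {a b : Fin n} → a ≢ b → ∀ i → samePair i i a b ≡ false
samePair-irrefl a≢b i = Bool.¬-not λ e → case samePair-true {i = i} e of λ
  { (inj₁ (i≡a , i≡b)) → a≢b (trans (≡-sym i≡a) i≡b)
  ; (inj₂ (i≡b , i≡a)) → a≢b (trans (≡-sym i≡a) i≡b) }

samePair-refl : ∀ (a b : Fin n) → samePair a b a b ≡ true
samePair-refl a b rewrite ≟ᶠᵇ-refl a | ≟ᶠᵇ-refl b = refl

setPair : (G : Graph n) (a b : Fin n) → a ≢ b → Bool → Graph n
setPair G a b a≢b v = record
  { adj    = λ i j → if samePair i j a b then v else adj G i j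
  ; sym    = λ i j → cong₂ (if_then v else_) (samePair-sym i j a b) (sym G i j)
  ; irrefl = λ i → trans (cong (if_then v else adj G i i) (samePair-irrefl a≢b i)) (irrefl G i)
  }

samePair-false : ∀ {i j a b : Fin n} → ¬ (i ≡ a × j ≡ b) → ¬ (i ≡ b × j ≡ a) → samePair i j a b ≡ false
samePair-false {i = i} ¬ab ¬ba = Bool.¬-not λ e → case samePair-true {i = i} e of λ
  { (inj₁ ab) → ¬ab ab ; (inj₂ ba) → ¬ba ba }

adj-setPair-same : ∀ (G : Graph n) {a b} (a≢b : a ≢ b) v {i j} → samePair i j a b ≡ true →
                   adj (setPair G a b a≢b v) i j ≡ v
adj-setPair-same G a≢b v same rewrite same = refl

adj-setPair-other : ∀ (G : Graph n) {a b} (a≢b : a ≢ b) v i j → ¬ (i ≡ a × j ≡ b) → ¬ (i ≡ b × j ≡ a) →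
                    adj (setPair G a b a≢b v) i j ≡ adj G i j
adj-setPair-other G {a} {b} a≢b v i j ¬ab ¬ba rewrite samePair-false {i = i} {j} {a} {b} ¬ab ¬ba = refl

incidence : (i a b : Fin n) → ℕ
incidence i a b = bit (i ≟ᶠᵇ a) + bit (i ≟ᶠᵇ b)

-- Only the rows of `a` and `b` can change, each in a single entry; the factor `incidence i a b`
-- treats all rows alike, so that the changes of several pairs add up.
#-setPair : ∀ (G : Graph n) {a b} (a≢b : a ≢ b) v i →
            # (adj (setPair G a b a≢b v) i) + incidence i a b * bit (adj G a b)
              ≡ # (adj G i) + incidence i a b * bit v
#-setPair G {a} {b} a≢b v i = row (i ≟ᶠ a) (i ≟ᶠ b)
  where
  G′ = setPair G a b a≢b v
  Claim : Bool → Bool → Set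
  Claim p q = # (adj G′ i) + (bit p + bit q) * bit (adj G a b) ≡ # (adj G i) + (bit p + bit q) * bit v
  row : (i≟a : Dec (i ≡ a)) (i≟b : Dec (i ≡ b)) → Claim (does i≟a) (does i≟b)
  row (yes refl) (yes refl) = contradiction refl a≢b
  row (yes refl) (no  _) rewrite +-identityʳ (bit (adj G a b)) | +-identityʳ (bit v) =
    subst (λ w → # (adj G′ a) + bit (adj G a b) ≡ # (adj G a) + bit w)
      (adj-setPair-same G a≢b v {a} {b} (samePair-refl a b))
      (#-update b λ j j≢b → adj-setPair-other G a≢b v a j (j≢b ∘ proj₂) (a≢b ∘ proj₁))
  row (no  _) (yes refl) rewrite +-identityʳ (bit (adj G a b)) | +-identityʳ (bit v) | sym G a b =
    subst (λ w → # (adj G′ b) + bit (adj G b a) ≡ # (adj G b) + bit w)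
      (adj-setPair-same G a≢b v {b} {a} (trans (samePair-sym b a a b) (samePair-refl a b)))
      (#-update a λ j j≢a → adj-setPair-other G a≢b v b j (a≢b ∘ ≡-sym ∘ proj₁) (j≢a ∘ proj₂))
  row (no i≢a) (no i≢b) = cong (_+ 0)
    (#-cong λ j → adj-setPair-other G a≢b v i j (i≢a ∘ proj₁) (i≢b ∘ proj₁))

-- General switches.

-- A 4-cycle alternating between edges and non-edges. A non-adjacent pair may have equal ends, so
-- `p ≢ r` and `q ≢ s` are required; the other four inequalities follow from the adjacencies.
record Alternating (G : Graph n) (p q r s : Fin n) : Set where
  field
    p≢r : p ≢ r
    q≢s : q ≢ s
    pq  : adj G p q ≡ true
    rs  : adj G r s ≡ true
    pr  : adj G p r ≡ false
    qs  : adj G q s ≡ false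

  p≢q : p ≢ q
  p≢q refl = true≢false pq (irrefl G p)
  r≢s : r ≢ s
  r≢s refl = true≢false rs (irrefl G r)
  p≢s : p ≢ s
  p≢s refl = true≢false (trans (sym G q p) pq) qs
  q≢r : q ≢ r
  q≢r refl = true≢false pq pr

  remove-pq = setPair G p q p≢q false
  remove-rs = setPair remove-pq r s r≢s false
  insert-pr = setPair remove-rs p r p≢r true
  switch    = setPair insert-pr q s q≢s true

  #-switch : ∀ i → # (adj switch i) ≡ # (adj G i)
  #-switch i = begin
    # (adj switch i)                              ≡⟨ inserted insert-pr q≢s i qs′ ⟩
    # (adj insert-pr i) + e q s                   ≡⟨ cong (_+ e q s) (inserted remove-rs p≢r i pr′) ⟩
    -- The removed pairs and the inserted pairs both cover each corner once, so the incidences only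
    -- need regrouping.
    # (adj remove-rs i) + e p r + e q s           ≡⟨ regroup (# (adj remove-rs i)) (bit (i ≟ᶠᵇ p)) _ _ _ ⟩
    # (adj remove-rs i) + e r s + e p q           ≡⟨ cong (_+ e p q) (removed remove-pq r≢s i rs′) ⟩
    # (adj remove-pq i) + e p q                   ≡⟨ removed G p≢q i pq ⟩
    # (adj G i)                                   ∎
    where
    open ≡-Reasoning
    e = incidence i
    regroup : ∀ k p q r s → k + (p + r) + (q + s) ≡ k + (r + s) + (p + q)
    regroup = solve-∀
    inserted : ∀ (G : Graph n) {a b} (a≢b : a ≢ b) i → adj G a b ≡ false →
               # (adj (setPair G a b a≢b true) i) ≡ # (adj G i) + incidence i a b
    inserted G {a} {b} a≢b i ab with #-setPair G a≢b true i
    ... | eq rewrite ab | *-zeroʳ (incidence i a b) | *-identityʳ (incidence i a b)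
                   | +-identityʳ (# (adj (setPair G a b a≢b true) i)) = eq
    removed : ∀ (G : Graph n) {a b} (a≢b : a ≢ b) i → adj G a b ≡ true →
              # (adj (setPair G a b a≢b false) i) + incidence i a b ≡ # (adj G i)
    removed G {a} {b} a≢b i ab with #-setPair G a≢b false i
    ... | eq rewrite ab | *-zeroʳ (incidence i a b) | *-identityʳ (incidence i a b)
                   | +-identityʳ (# (adj G i)) = eq
    rs′ : adj remove-pq r s ≡ true
    rs′ = trans (adj-setPair-other G p≢q false r s (p≢r ∘ ≡-sym ∘ proj₁) (q≢r ∘ ≡-sym ∘ proj₁)) rs
    pr′ : adj remove-rs p r ≡ false
    pr′ = trans (adj-setPair-other remove-pq r≢s false p r (p≢r ∘ proj₁) (p≢s ∘ proj₁))
         (trans (adj-setPair-other G p≢q false p r (q≢r ∘ ≡-sym ∘ proj₂) (p≢q ∘ proj₁)) pr)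
    qs′ : adj insert-pr q s ≡ false
    qs′ = trans (adj-setPair-other remove-rs p≢r true q s (p≢q ∘ ≡-sym ∘ proj₁) (q≢r ∘ proj₁))
         (trans (adj-setPair-other remove-pq r≢s false q s (q≢r ∘ proj₁) (q≢s ∘ proj₁))
         (trans (adj-setPair-other G p≢q false q s (p≢q ∘ ≡-sym ∘ proj₁) (p≢s ∘ ≡-sym ∘ proj₂)) qs))

  switch-regular : ∀ {d} → Regular d G → Regular d switch
  switch-regular reg i = trans (degree≡# switch i) (trans (#-switch i) (trans (≡-sym (degree≡# G i)) (reg i)))

  switch-rewired : Rewired G switch p q r s p r q s
  switch-rewired i j =
    formula (samePair i j q s) (samePair i j p r) (samePair i j r s) (samePair i j p q) (adj G i j)
    where
    formula : ∀ qs pr rs pq g →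
      (if qs then true else if pr then true else if rs then false else if pq then false else g)
        ≡ (g ∧ not pq ∧ not rs) ∨ pr ∨ qs
    formula true  true  _     _     _     = ≡-sym (Bool.∨-zeroʳ _)
    formula true  false _     _     _     = ≡-sym (Bool.∨-zeroʳ _)
    formula false true  _     _     _     = ≡-sym (Bool.∨-zeroʳ _)
    formula false false true  true  true  = refl
    formula false false true  true  false = refl
    formula false false true  false true  = refl
    formula false false true  false false = refl
    formula false false false true  true  = refl
    formula false false false true  false = refl
    formula false false false false true  = refl
    formula false false false false false = refl

-- Partial knowledge of a graph, moves and strategies.

-- A partial adjacency matrix on numbered names, with `nothing` for an adjacency not yet known.
Knowledge : Set
Knowledge = ℕ → ℕ → Maybe Bool

same : (i j a b : ℕ) → Bool
same i j a b = ((i ≡ᵇ a) ∧ (j ≡ᵇ b)) ∨ ((i ≡ᵇ b) ∧ (j ≡ᵇ a))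

learn : Knowledge → ℕ → ℕ → Bool → Knowledge
learn K a b v i j = if same i j a b then just v else K i j

-- A table that is correct on the names below `a` may hold anything at `a`; this is erased before
-- `a` comes to denote a vertex.
forget : ℕ → Knowledge → Knowledge
forget a K i j = if (i ≡ᵇ a) ∨ (j ≡ᵇ a) then nothing else K i j

-- In switch positions p q r s, the edges pq, rs are replaced by pr, qs.
switchᴷ : Knowledge → (p q r s : ℕ) → Knowledge
switchᴷ K p q r s = learn (learn (learn (learn K p q false) r s false) p r true) q s true

data Move : Set where
  Δ⁺ Δ⁻ : (v x y w z : ℕ) → Move

apply : Knowledge → Move → Knowledge
apply K (Δ⁺ v x y w z) = switchᴷ K x y w z
apply K (Δ⁻ v x y w z) = switchᴷ K x w y z

Switchable : ℕ → Knowledge → (p q r s : ℕ) → Set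
Switchable N K p q r s =
  (p < N × q < N × r < N × s < N) × (p ≢ r × q ≢ s) ×
  (K p q ≡ just true × K r s ≡ just true × K p r ≡ just false × K q s ≡ just false)

-- A Δ-switch is a general switch together with a vertex `v` adjacent to both ends of `xw`, the pair
-- inserted by `Δ⁺` and removed by `Δ⁻`.
Apex : ℕ → Knowledge → (v x y w z : ℕ) → Set
Apex N K v x y w z =
  v < N × (v ≢ x × v ≢ y × v ≢ w × v ≢ z) × (K v x ≡ just true × K v w ≡ just true)

Allowed : ℕ → Knowledge → Move → Set
Allowed N K (Δ⁺ v x y w z) = Switchable N K x y w z × Apex N K v x y w z
Allowed N K (Δ⁻ v x y w z) = Switchable N K x w y z × Apex N K v x y w z

-- The final tables must also have the same unknown entries, so that no pair is touched on one side
-- only.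
Leads : ℕ → Knowledge → List Move → Knowledge → Set
Leads N K []       K′ = ∀ {a} → a < N → ∀ {b} → b < N → K a b ≡ K′ a b
Leads N K (m ∷ ms) K′ = Allowed N K m × Leads N (apply K m) ms K′

-- The numbers below 4 + k name distinct vertices; 0, 1, 2, 3 are the corners p, q, r, s of the switch to be
-- simulated.
data Strategy : Set where
  moves     : List Move → Strategy
  query     : (a b : ℕ) (adjacent nonadjacent : Strategy) → Strategy
  neighbour : (u : ℕ) → Strategy → Strategy

_≟ᴹ_ : (x y : Maybe Bool) → Dec (x ≡ y)
_≟ᴹ_ = Maybe.≡-dec Bool._≟_

knownNeighbours : ℕ → Knowledge → ℕ → List ℕ
knownNeighbours N K u = filter (λ t → K u t ≟ᴹ just true) (upTo N)

-- In the last clause, all adjacencies between u and the named vertices are known and fewer than three of them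
-- are edges, so a further neighbour of u has no name yet; it receives the name 4 + k.
Wins : ℕ → Knowledge → Strategy → Set
Wins k K (moves ms)      = Leads (4 + k) K ms (switchᴷ K 0 1 2 3)
Wins k K (query a b σ τ) =
  (a < 4 + k × b < 4 + k) × Wins k (learn K a b true) σ × Wins k (learn K a b false) τ
Wins k K (neighbour u σ) =
  u < 4 + k × (∀ {t} → t < 4 + k → t ≡ u ⊎ K u t ≢ nothing) × length (knownNeighbours (4 + k) K u) < 3 ×
  Wins (suc k) (learn (forget (4 + k) K) u (4 + k) true) σ

switchable? : ∀ N K p q r s → Dec (Switchable N K p q r s)
switchable? N K p q r s =
  ((p <? N) ×-dec (q <? N) ×-dec (r <? N) ×-dec (s <? N)) ×-dec (¬? (p ≟ r) ×-dec ¬? (q ≟ s)) ×-dec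
  ((K p q ≟ᴹ just true) ×-dec (K r s ≟ᴹ just true) ×-dec (K p r ≟ᴹ just false) ×-dec (K q s ≟ᴹ just false))

apex? : ∀ N K v x y w z → Dec (Apex N K v x y w z)
apex? N K v x y w z =
  (v <? N) ×-dec (¬? (v ≟ x) ×-dec ¬? (v ≟ y) ×-dec ¬? (v ≟ w) ×-dec ¬? (v ≟ z)) ×-dec
  ((K v x ≟ᴹ just true) ×-dec (K v w ≟ᴹ just true))

allowed? : ∀ N K m → Dec (Allowed N K m)
allowed? N K (Δ⁺ v x y w z) = switchable? N K x y w z ×-dec apex? N K v x y w z
allowed? N K (Δ⁻ v x y w z) = switchable? N K x w y z ×-dec apex? N K v x y w z

leads? : ∀ N K ms K′ → Dec (Leads N K ms K′)
leads? N K []       K′ = allUpTo? (λ a → allUpTo? (λ b → K a b ≟ᴹ K′ a b) N) N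
leads? N K (m ∷ ms) K′ = allowed? N K m ×-dec leads? N (apply K m) ms K′

wins? : ∀ k K σ → Dec (Wins k K σ)
wins? k K (moves ms)      = leads? (4 + k) K ms (switchᴷ K 0 1 2 3)
wins? k K (query a b σ τ) =
  ((a <? 4 + k) ×-dec (b <? 4 + k)) ×-dec wins? k (learn K a b true) σ ×-dec wins? k (learn K a b false) τ
wins? k K (neighbour u σ) =
  (u <? 4 + k) ×-dec allUpTo? (λ t → (t ≟ u) ⊎-dec ¬? (K u t ≟ᴹ nothing)) (4 + k) ×-dec
  (length (knownNeighbours (4 + k) K u) <? 3) ×-dec
  wins? (suc k) (learn (forget (4 + k) K) u (4 + k) true) σ

-- The winning strategy.

initial : Knowledge
initial = learn (learn (learn (learn (λ _ _ → nothing) 0 1 true) 2 3 true) 0 2 false) 1 3 false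

-- Found by computer search.  The last line is the generic case.
strategy : Strategy
strategy =
  query 0 3
    (query 1 2
       (neighbour 0 $
        query 3 4 (moves (Δ⁻ 4 3 1 0 2 ∷ Δ⁺ 4 3 2 0 1 ∷ [])) $
        moves (Δ⁺ 1 0 4 2 3 ∷ Δ⁻ 2 0 4 1 3 ∷ [])) $
     neighbour 2 $
     query 1 4
       (neighbour 2 $
        query 1 5
          (query 0 4 (moves (Δ⁺ 4 0 1 2 3 ∷ [])) $
           query 0 5 (moves (Δ⁻ 5 0 2 1 3 ∷ [])) $
           moves (Δ⁺ 5 1 0 2 4 ∷ Δ⁺ 2 3 0 1 5 ∷ Δ⁻ 1 3 0 2 4 ∷ Δ⁻ 4 2 0 1 5 ∷ [])) $
        moves (Δ⁺ 3 2 5 0 1 ∷ Δ⁻ 0 3 1 2 5 ∷ [])) $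
     moves (Δ⁺ 3 0 1 2 4 ∷ Δ⁻ 0 3 1 2 4 ∷ [])) $
  neighbour 0 $
  neighbour 0 $
  query 2 5 (moves (Δ⁺ 5 0 1 2 3 ∷ [])) $
  query 1 4 (moves (Δ⁻ 4 0 2 1 3 ∷ [])) $
  query 3 4
    (query 1 2
       (query 3 5 (moves (Δ⁺ 5 0 1 3 4 ∷ Δ⁻ 0 3 1 5 2 ∷ Δ⁺ 0 4 1 3 2 ∷ Δ⁻ 4 3 5 0 2 ∷ [])) $
        moves (Δ⁺ 1 0 5 2 3 ∷ Δ⁻ 2 0 5 1 3 ∷ [])) $
     moves (Δ⁺ 4 3 2 0 1 ∷ Δ⁻ 4 3 1 0 2 ∷ [])) $
  query 4 5 (moves (Δ⁻ 5 4 3 0 2 ∷ Δ⁺ 5 4 3 0 1 ∷ [])) $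
  query 2 4 (moves (Δ⁺ 4 0 1 2 3 ∷ [])) $
  neighbour 4 $
  query 0 6 (moves (Δ⁻ 6 4 3 0 2 ∷ Δ⁺ 6 4 3 0 1 ∷ [])) $
  query 1 5 (moves (Δ⁻ 5 0 2 1 3 ∷ [])) $
  query 2 6 (moves (Δ⁺ 4 0 5 6 2 ∷ Δ⁻ 0 4 5 6 2 ∷ Δ⁺ 6 2 3 0 1 ∷ Δ⁻ 2 6 4 0 5 ∷ [])) $
  query 5 6
    (query 3 6 (moves (Δ⁺ 4 0 1 6 3 ∷ Δ⁻ 4 0 2 6 3 ∷ [])) $
     moves (Δ⁺ 5 6 4 0 1 ∷ Δ⁻ 0 5 2 6 3 ∷ Δ⁺ 0 4 1 6 3 ∷ Δ⁻ 4 0 2 6 5 ∷ [])) $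
  query 3 5
    (query 1 2 (moves (Δ⁺ 1 0 4 2 3 ∷ Δ⁻ 2 0 4 1 3 ∷ [])) $
     moves (Δ⁺ 5 3 2 0 1 ∷ Δ⁻ 5 3 1 0 2 ∷ [])) $
  neighbour 5 $
  query 6 7
    (query 0 7 (moves (Δ⁻ 7 0 2 5 3 ∷ Δ⁺ 7 0 1 5 3 ∷ [])) $
     query 1 7 (moves (Δ⁺ 1 0 4 7 5 ∷ Δ⁻ 7 1 3 0 2 ∷ Δ⁺ 0 7 1 5 4 ∷ Δ⁻ 5 0 4 7 1 ∷ [])) $
     moves (Δ⁺ 4 0 1 6 7 ∷ Δ⁻ 4 0 3 6 2 ∷ Δ⁺ 5 0 3 7 1 ∷ Δ⁻ 5 0 2 7 6 ∷ [])) $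
  moves (Δ⁺ 0 4 6 5 7 ∷ Δ⁻ 4 5 3 0 2 ∷ Δ⁺ 4 5 3 0 1 ∷ Δ⁻ 0 4 6 5 7 ∷ [])

strategy-wins : Wins 0 initial strategy
strategy-wins = toWitness {a? = wins? 0 initial strategy} _

-- Soundness of strategies.

-- K is correct about G, and G differs from G₀ only in pairs on which K has an opinion.  The latter makes
-- graphs described by the same knowledge equal.
record Describes {n} (ρ : ℕ → Fin n) (N : ℕ) (K : Knowledge) (G₀ G : Graph n) : Set where
  field
    known   : ∀ {a b v} → a < N → b < N → K a b ≡ just v → adj G (ρ a) (ρ b) ≡ v
    outside : ∀ i j → adj G i j ≡ adj G₀ i j ⊎
              ∃₂ λ a b → (a < N × b < N) × (i ≡ ρ a × j ≡ ρ b) × ∃ λ v → K a b ≡ just v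
open Describes

InjectiveBelow : ℕ → (ℕ → Fin n) → Set
InjectiveBelow N ρ = ∀ {a b} → a < N → b < N → ρ a ≡ ρ b → a ≡ b

≡ᵇ-refl : ∀ a → (a ≡ᵇ a) ≡ true
≡ᵇ-refl a = dec-true (a ≟ a) refl

≡ᵇ-true : ∀ a b → (a ≡ᵇ b) ≡ true → a ≡ b
≡ᵇ-true a b e = ≡ᵇ⇒≡ a b (subst T (≡-sym e) _)

same-refl : ∀ a b → same a b a b ≡ true
same-refl a b rewrite ≡ᵇ-refl a | ≡ᵇ-refl b = refl

same-sym : ∀ i j a b → same i j a b ≡ same j i a b
same-sym i j a b = trans (Bool.∨-comm ((i ≡ᵇ a) ∧ (j ≡ᵇ b)) _)
  (cong₂ _∨_ (Bool.∧-comm (i ≡ᵇ b) _) (Bool.∧-comm (i ≡ᵇ a) _))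

same-true : ∀ i j a b → same i j a b ≡ true → (i ≡ a × j ≡ b) ⊎ (i ≡ b × j ≡ a)
same-true i j a b e with i ≡ᵇ a in ia | j ≡ᵇ b in jb | i ≡ᵇ b in ib | j ≡ᵇ a in ja
... | true  | true  | _    | _    = inj₁ (≡ᵇ-true i a ia , ≡ᵇ-true j b jb)
... | true  | false | true | true = inj₂ (≡ᵇ-true i b ib , ≡ᵇ-true j a ja)
... | false | _     | true | true = inj₂ (≡ᵇ-true i b ib , ≡ᵇ-true j a ja)

-- Information is gathered before any move, while the two graphs still coincide and `outside` is
-- trivial.
Describes-learned : ∀ {ρ : ℕ → Fin n} {N K G a b v} → Describes ρ N K G G → adj G (ρ a) (ρ b) ≡ v →
                    Describes ρ N (learn K a b v) G G
Describes-learned {ρ = ρ} {N} {K} {G} {a} {b} {v} D ab = record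
  { known = knows ; outside = λ i j → inj₁ refl }
  where
  knows : ∀ {i j w} → i < N → j < N → learn K a b v i j ≡ just w → adj G (ρ i) (ρ j) ≡ w
  knows {i} {j} i<N j<N e with same i j a b in ij
  ... | false = known D i<N j<N e
  ... | true with same-true i j a b ij
  ...   | inj₁ (refl , refl) = trans ab (Maybe.just-injective e)
  ...   | inj₂ (refl , refl) = trans (sym G _ _) (trans ab (Maybe.just-injective e))

-- A pair is either as in `G₀` on both sides, or one table has an opinion on it; then the other
-- table has the same one.
SameGraph-from-knowledge : ∀ {ρ : ℕ → Fin n} {N K K′ G₀ G H} →
  Describes ρ N K G₀ G → Describes ρ N K′ G₀ H →
  (∀ {a} → a < N → ∀ {b} → b < N → K a b ≡ K′ a b) → SameGraph G H
SameGraph-from-knowledge D E K≗K′ i j with outside D i j | outside E i j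
... | inj₁ G≡G₀ | inj₁ H≡G₀ = trans G≡G₀ (≡-sym H≡G₀)
... | inj₂ (a , b , (a<N , b<N) , (refl , refl) , v , Kab) | _ =
  trans (known D a<N b<N Kab) (≡-sym (known E a<N b<N (trans (≡-sym (K≗K′ a<N b<N)) Kab)))
... | inj₁ _ | inj₂ (a , b , (a<N , b<N) , (refl , refl) , v , K′ab) =
  trans (known D a<N b<N (trans (K≗K′ a<N b<N) K′ab)) (≡-sym (known E a<N b<N K′ab))

module _ {ρ : ℕ → Fin n} {N : ℕ} (ρ-inj : InjectiveBelow N ρ) where

  ρ-≢ : ∀ {a b} → a < N → b < N → a ≢ b → ρ a ≢ ρ b
  ρ-≢ a<N b<N a≢b = a≢b ∘ ρ-inj a<N b<N

  ≟ᶠᵇ-ρ : ∀ {a b} → a < N → b < N → (ρ a ≟ᶠᵇ ρ b) ≡ (a ≡ᵇ b)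
  ≟ᶠᵇ-ρ {a} {b} a<N b<N with a ≟ b
  ... | yes refl = trans (≟ᶠᵇ-refl (ρ a)) (≡-sym (≡ᵇ-refl a))
  ... | no a≢b   = trans (dec-false (ρ a ≟ᶠ ρ b) (ρ-≢ a<N b<N a≢b)) (≡-sym (dec-false (a ≟ b) a≢b))

  samePair-ρ : ∀ {i j a b} → i < N → j < N → a < N → b < N →
               samePair (ρ i) (ρ j) (ρ a) (ρ b) ≡ same i j a b
  samePair-ρ i<N j<N a<N b<N
    rewrite ≟ᶠᵇ-ρ i<N a<N | ≟ᶠᵇ-ρ j<N b<N | ≟ᶠᵇ-ρ i<N b<N | ≟ᶠᵇ-ρ j<N a<N = refl

  -- Injectivity of `ρ` makes comparing vertices the same as comparing names, so graph and table
  -- change in the same places. The changed pair receives an opinion, as `outside` demands.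
  Describes-setPair : ∀ {K G₀ G a b} → a < N → b < N → (ρa≢ρb : ρ a ≢ ρ b) → ∀ v →
    Describes ρ N K G₀ G → Describes ρ N (learn K a b v) G₀ (setPair G (ρ a) (ρ b) ρa≢ρb v)
  Describes-setPair {K} {G₀} {G} {a} {b} a<N b<N ρa≢ρb v D = record { known = knows ; outside = out }
    where
    G′ = setPair G (ρ a) (ρ b) ρa≢ρb v
    K′ = learn K a b v
    knows : ∀ {i j w} → i < N → j < N → K′ i j ≡ just w → adj G′ (ρ i) (ρ j) ≡ w
    knows {i} {j} i<N j<N e rewrite samePair-ρ i<N j<N a<N b<N with same i j a b
    ... | true  = Maybe.just-injective e
    ... | false = known D i<N j<N e
    still : ∀ i j {w} → K i j ≡ just w → ∃ λ w → K′ i j ≡ just w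
    still i j e with same i j a b
    ... | true  = v , refl
    ... | false = _ , e
    out : ∀ i j → adj G′ i j ≡ adj G₀ i j ⊎
          ∃₂ λ c e → (c < N × e < N) × (i ≡ ρ c × j ≡ ρ e) × ∃ λ w → K′ c e ≡ just w
    out i j with samePair i j (ρ a) (ρ b) in ij
    ... | true with samePair-true {i = i} ij
    ...   | inj₁ ij≡ab = inj₂ (a , b , (a<N , b<N) , ij≡ab , v , cong (if_then just v else K a b) (same-refl a b))
    ...   | inj₂ ij≡ba = inj₂ (b , a , (b<N , a<N) , ij≡ba , v ,
              cong (if_then just v else K b a) (trans (same-sym b a a b) (same-refl a b)))
    out i j | false with outside D i j
    ...   | inj₁ G≡G₀ = inj₁ G≡G₀
    ...   | inj₂ (c , e , lt , ij≡ce , w , Kce) = inj₂ (c , e , lt , ij≡ce , still c e Kce)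

  Describes-switch : ∀ {K G₀ G p q r s} → p < N → q < N → r < N → s < N →
    Describes ρ N K G₀ G → (alt : Alternating G (ρ p) (ρ q) (ρ r) (ρ s)) →
    Describes ρ N (switchᴷ K p q r s) G₀ (Alternating.switch alt)
  Describes-switch p<N q<N r<N s<N D alt =
    Describes-setPair q<N s<N q≢s true (Describes-setPair p<N r<N p≢r true
      (Describes-setPair r<N s<N r≢s false (Describes-setPair p<N q<N p≢q false D)))
    where open Alternating alt

  alternating : ∀ {K G₀ G p q r s} → Describes ρ N K G₀ G → Switchable N K p q r s →
                Alternating G (ρ p) (ρ q) (ρ r) (ρ s)
  alternating D ((p<N , q<N , r<N , s<N) , (p≢r , q≢s) , (pq , rs , pr , qs)) = record
    { p≢r = ρ-≢ p<N r<N p≢r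
    ; q≢s = ρ-≢ q<N s<N q≢s
    ; pq  = known D p<N q<N pq
    ; rs  = known D r<N s<N rs
    ; pr  = known D p<N r<N pr
    ; qs  = known D q<N s<N qs
    }

  -- Of the ten inequalities in `Distinct5`, the alternating cycle yields six and the apex condition
  -- the four that involve `v`.
  move-sound : ∀ {K G₀ G} m → Allowed N K m → Describes ρ N K G₀ G → Regular d G →
               ∃ λ G′ → MStep d G G′ × Describes ρ N (apply K m) G₀ G′
  move-sound {G = G} (Δ⁺ v x y w z)
    (sw@((x<N , y<N , w<N , z<N) , _) , v<N , (v≢x , v≢y , v≢w , v≢z) , (vx , vw)) D reg =
    switch , (reg , switch-regular reg , inj₁ (ρ v , ρ x , ρ y , ρ w , ρ z ,
      (ρ-≢ v<N x<N v≢x , ρ-≢ v<N y<N v≢y , ρ-≢ v<N w<N v≢w , ρ-≢ v<N z<N v≢z ,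
       p≢q , p≢r , p≢s , q≢r , q≢s , r≢s) ,
      trans (sym G _ _) pq , trans (sym G _ _) (known D v<N x<N vx) , known D v<N w<N vw , rs ,
      Bool.not-¬ pr , Bool.not-¬ qs , switch-rewired)) ,
    Describes-switch x<N y<N w<N z<N D alt
    where
    alt = alternating D sw
    open Alternating alt
  move-sound {G = G} (Δ⁻ v x y w z)
    (sw@((x<N , w<N , y<N , z<N) , _) , v<N , (v≢x , v≢y , v≢w , v≢z) , (vx , vw)) D reg =
    switch , (reg , switch-regular reg , inj₂ (ρ v , ρ x , ρ y , ρ w , ρ z ,
      (ρ-≢ v<N x<N v≢x , ρ-≢ v<N y<N v≢y , ρ-≢ v<N w<N v≢w , ρ-≢ v<N z<N v≢z ,
       p≢r , p≢q , p≢s , q≢r ∘ ≡-sym , r≢s , q≢s) ,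
      known D v<N x<N vx , pq , trans (sym G _ _) (known D v<N w<N vw) , rs ,
      Bool.not-¬ pr , Bool.not-¬ qs , switch-rewired)) ,
    Describes-switch x<N w<N y<N z<N D alt
    where
    alt = alternating D sw
    open Alternating alt

  -- The target `H` stays fixed while `G` follows the moves; both are described relative to the same
  -- `G₀`, so equal final tables give equal graphs.
  moves-sound : ∀ {K K′ G₀ G H} ms → Leads N K ms K′ → Describes ρ N K G₀ G → Describes ρ N K′ G₀ H →
                Regular d G → Reachable d G H
  moves-sound []       K≗K′ D E reg = _ , ε , SameGraph-from-knowledge D E K≗K′
  moves-sound (m ∷ ms) (allowed , leads) D E reg
    with move-sound m allowed D reg
  ... | G′ , step@(_ , reg′ , _) , D′ with moves-sound ms leads D′ E reg′
  ... | H′ , steps , H′≈H = H′ , step ◅ steps , H′≈H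

name : ℕ → Fin n → (ℕ → Fin n) → ℕ → Fin n
name N j ρ a = if a ≡ᵇ N then j else ρ a

module _ {G : Graph n} (reg : Regular d G) (3≤d : 3 ≤ d) where

  -- Induction on the strategy: a query follows the branch of the actual adjacency, a neighbour
  -- request extends the naming, and `G` itself is unchanged until a leaf is reached.
  wins-sound : ∀ k {K} {ρ : ℕ → Fin n} σ → Wins k K σ →
    InjectiveBelow (4 + k) ρ → Describes ρ (4 + k) K G G →
    (alt : Alternating G (ρ 0) (ρ 1) (ρ 2) (ρ 3)) → Reachable d G (Alternating.switch alt)
  wins-sound k (moves ms) leads inj D alt =
    moves-sound inj ms leads D (Describes-switch inj (s≤s z≤n) (s≤s (s≤s z≤n))
      (s≤s (s≤s (s≤s z≤n))) (s≤s (s≤s (s≤s (s≤s z≤n)))) D alt) reg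
  wins-sound k {ρ = ρ} (query a b σ τ) (_ , w , w′) inj D alt with adj G (ρ a) (ρ b) in ab
  ... | true  = wins-sound k σ w  inj (Describes-learned D ab) alt
  ... | false = wins-sound k τ w′ inj (Describes-learned D ab) alt
  wins-sound k {K} {ρ} (neighbour u σ) (u<N , complete , few , w) inj D alt =
    -- The new name is at least 4, so `ρ′` computes to `ρ` on the corners and `alt` keeps its type.
    wins-sound (suc k) {ρ = ρ′} σ w inj′ (Describes-learned D′ u-N) alt
    where
    N = 4 + k
    L = map ρ (knownNeighbours N K u)
    -- Here `3 ≤ d` enters: fewer than three neighbours are listed, so one is left.
    L<deg : length L < # (adj G (ρ u))
    L<deg rewrite length-map ρ (knownNeighbours N K u) | ≡-sym (degree≡# G (ρ u)) | reg (ρ u) =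
      ≤-trans few 3≤d
    new = #-outside (adj G (ρ u)) L L<deg
    j = proj₁ new
    -- A named `j` would be `u` itself, against irreflexivity, or a vertex whose adjacency to `u` is
    -- known; being an edge, it would put `j` in `L`.
    fresh : ∀ {t} → t < N → ρ t ≢ j
    fresh {t} t<N ρt≡j with complete t<N
    ... | inj₁ refl = true≢false (proj₁ (proj₂ new)) (trans (cong (adj G (ρ t)) (≡-sym ρt≡j)) (irrefl G (ρ t)))
    ... | inj₂ K≢nothing with K u t in Kut
    ...   | nothing = K≢nothing refl
    ...   | just v  = proj₂ (proj₂ new) (subst (_∈ L) ρt≡j (∈-map⁺ ρ (∈-filter⁺ (λ t → K u t ≟ᴹ just true) (∈-upTo⁺ t<N)
              (trans Kut (cong just (trans (≡-sym (known D u<N t<N Kut))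
                (trans (cong (adj G (ρ u)) ρt≡j) (proj₁ (proj₂ new)))))))))
    ρ′ = name N j ρ
    -- The Boolean equation is stored because `forget` branches on it.
    data Below (a : ℕ) : Set where
      old  : a < N → ρ′ a ≡ ρ a → (a ≡ᵇ N) ≡ false → Below a
      last : a ≡ N → ρ′ a ≡ j → (a ≡ᵇ N) ≡ true → Below a
    below : ∀ {a} → a < suc N → Below a
    below {a} a<1+N with a ≟ N
    ... | yes refl = last refl (cong (if_then j else ρ N) (≡ᵇ-refl N)) (≡ᵇ-refl N)
    ... | no a≢N   = old (≤∧≢⇒< (≤-pred a<1+N) a≢N) (cong (if_then j else ρ a) a≢ᵇN) a≢ᵇN
      where a≢ᵇN = dec-false (a ≟ N) a≢N
    inj′ : InjectiveBelow (suc N) ρ′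
    inj′ a< b< e with below a< | below b<
    ... | old a<N ρ′a _  | old b<N ρ′b _  = inj a<N b<N (trans (≡-sym ρ′a) (trans e ρ′b))
    ... | old a<N ρ′a _  | last _ ρ′b _   = contradiction (trans (≡-sym ρ′a) (trans e ρ′b)) (fresh a<N)
    ... | last _ ρ′a _   | old b<N ρ′b _  = contradiction (trans (≡-sym ρ′b) (trans (≡-sym e) ρ′a)) (fresh b<N)
    ... | last a≡N _ _   | last b≡N _ _   = trans a≡N (≡-sym b≡N)
    knows : ∀ {a b v} → a < suc N → b < suc N → forget N K a b ≡ just v → adj G (ρ′ a) (ρ′ b) ≡ v
    knows {a} {b} a< b< e with below a< | below b<
    ... | old a<N ρ′a a≢N | old b<N ρ′b b≢N rewrite a≢N | b≢N = known D a<N b<N e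
    ... | old a<N ρ′a a≢N | last _ _ b≡N rewrite a≢N | b≡N = case e of λ ()
    ... | last _ _ a≡N    | _ rewrite a≡N = case e of λ ()
    D′ : Describes ρ′ (suc N) (forget N K) G G
    D′ = record { known = knows ; outside = λ i j → inj₁ refl }
    u-N : adj G (ρ′ u) (ρ′ N) ≡ true
    u-N with below (m≤n⇒m≤1+n u<N) | below (n<1+n N)
    ... | old _ ρ′u _ | last _ ρ′N _ = trans (cong₂ (adj G) ρ′u ρ′N) (proj₁ (proj₂ new))
    ... | _ | old N<N _ _ = contradiction N<N (n≮n N)
    ... | last refl _ _ | _ = contradiction u<N (n≮n N)

-- Every switch is a product of Δ-switches.

module Corners {G : Graph n} {p q r s : Fin n} (alt : Alternating G p q r s) where

  open Alternating alt

  corner : ℕ → Fin n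
  corner 0 = p
  corner 1 = q
  corner 2 = r
  -- This is also the default for names from 4 on, about which nothing is claimed.
  corner _ = s

  corner-injective : InjectiveBelow 4 corner
  corner-injective {0} {0} _ _ _ = refl
  corner-injective {0} {1} _ _ e = contradiction e p≢q
  corner-injective {0} {2} _ _ e = contradiction e p≢r
  corner-injective {0} {3} _ _ e = contradiction e p≢s
  corner-injective {1} {0} _ _ e = contradiction (≡-sym e) p≢q
  corner-injective {1} {1} _ _ _ = refl
  corner-injective {1} {2} _ _ e = contradiction e q≢r
  corner-injective {1} {3} _ _ e = contradiction e q≢s
  corner-injective {2} {0} _ _ e = contradiction (≡-sym e) p≢r
  corner-injective {2} {1} _ _ e = contradiction (≡-sym e) q≢r
  corner-injective {2} {2} _ _ _ = refl
  corner-injective {2} {3} _ _ e = contradiction e r≢s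
  corner-injective {3} {0} _ _ e = contradiction (≡-sym e) p≢s
  corner-injective {3} {1} _ _ e = contradiction (≡-sym e) q≢s
  corner-injective {3} {2} _ _ e = contradiction (≡-sym e) r≢s
  corner-injective {3} {3} _ _ _ = refl
  corner-injective {suc (suc (suc (suc _)))} (s≤s (s≤s (s≤s (s≤s ())))) _ _
  corner-injective {_} {suc (suc (suc (suc _)))} _ (s≤s (s≤s (s≤s (s≤s ())))) _

  0<4 : 0 < 4
  0<4 = s≤s z≤n
  1<4 : 1 < 4
  1<4 = s≤s (s≤s z≤n)
  2<4 : 2 < 4
  2<4 = s≤s (s≤s (s≤s z≤n))
  3<4 : 3 < 4
  3<4 = ≤-refl

  describes-G : Describes corner 4 initial G G
  describes-G = Describes-learned {a = 1} {3} (Describes-learned {a = 0} {2} (Describes-learned {a = 2} {3}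
    (Describes-learned {a = 0} {1} (record { known = λ { _ _ () } ; outside = λ i j → inj₁ refl }) pq) rs) pr) qs

  describes-switch : Describes corner 4 (switchᴷ initial 0 1 2 3) G switch
  describes-switch = Describes-switch corner-injective 0<4 1<4 2<4 3<4 describes-G alt

  switch-reachable : Regular d G → 3 ≤ d → Reachable d G switch
  switch-reachable reg 3≤d = wins-sound reg 3≤d 0 strategy strategy-wins corner-injective describes-G alt

  -- Exchanging the roles of `q` and `r` interchanges removed and inserted pairs; this undoes a
  -- switch made in the target graph.
  reversed : Alternating switch p r q s
  reversed = record
    { p≢r = p≢q
    ; q≢s = r≢s
    ; pq  = known describes-switch 0<4 2<4 refl
    ; rs  = known describes-switch 1<4 3<4 refl
    ; pr  = known describes-switch 0<4 1<4 refl
    ; qs  = known describes-switch 2<4 3<4 refl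
    }

  switch-involutive : SameGraph (Alternating.switch reversed) G
  switch-involutive = SameGraph-from-knowledge
    (Describes-switch corner-injective 0<4 2<4 1<4 3<4 describes-switch reversed) describes-G
    (toWitness {a? = leads? 4 (switchᴷ (switchᴷ initial 0 1 2 3) 0 2 1 3) [] initial} _)

  adj-switch-row : ∀ {i} → i ≢ p → i ≢ q → i ≢ r → i ≢ s → ∀ j → adj switch i j ≡ adj G i j
  adj-switch-row {i} i≢p i≢q i≢r i≢s j =
    trans (adj-setPair-other insert-pr q≢s true  i j (i≢q ∘ proj₁) (i≢s ∘ proj₁))
   (trans (adj-setPair-other remove-rs p≢r true  i j (i≢p ∘ proj₁) (i≢r ∘ proj₁))
   (trans (adj-setPair-other remove-pq r≢s false i j (i≢r ∘ proj₁) (i≢s ∘ proj₁))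
          (adj-setPair-other G         p≢q false i j (i≢p ∘ proj₁) (i≢q ∘ proj₁))))

  adj-switch-p : ∀ {j} → j ≢ q → j ≢ r → adj switch p j ≡ adj G p j
  adj-switch-p {j} j≢q j≢r =
    trans (adj-setPair-other insert-pr q≢s true  p j (p≢q ∘ proj₁) (p≢s ∘ proj₁))
   (trans (adj-setPair-other remove-rs p≢r true  p j (j≢r ∘ proj₂) (p≢r ∘ proj₁))
   (trans (adj-setPair-other remove-pq r≢s false p j (p≢r ∘ proj₁) (p≢s ∘ proj₁))
          (adj-setPair-other G         p≢q false p j (j≢q ∘ proj₂) (p≢q ∘ proj₁))))

-- Reachability up to equal adjacency.

SameGraph-trans : {G H K : Graph n} → SameGraph G H → SameGraph H K → SameGraph G K
SameGraph-trans G≈H H≈K i j = trans (G≈H i j) (H≈K i j)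

Regular-resp : {G H : Graph n} → SameGraph G H → Regular d G → Regular d H
Regular-resp {G = G} {H} G≈H reg i =
  trans (degree≡# H i) (trans (#-cong (≡-sym ∘ G≈H i)) (trans (≡-sym (degree≡# G i)) (reg i)))

Rewired-resp : {G H G′ : Graph n} → SameGraph G H → ∀ {a b c d e f g h} →
               Rewired G G′ a b c d e f g h → Rewired H G′ a b c d e f g h
Rewired-resp G≈H {a} {b} {c} {d} {e} {f} {g} {h} rw i j =
  trans (rw i j) (cong (λ x → (x ∧ not (samePair i j a b) ∧ not (samePair i j c d))
                                ∨ samePair i j e f ∨ samePair i j g h) (G≈H i j))

MStep-resp : {G H G′ : Graph n} → SameGraph G H → MStep d G G′ → MStep d H G′
MStep-resp {G = G} {H} {G′} G≈H (reg , reg′ , Δ) = Regular-resp {G = G} {H} G≈H reg , reg′ , Δ-resp Δ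
  where
  edge : ∀ {i j v} → adj G i j ≡ v → adj H i j ≡ v
  edge e = trans (≡-sym (G≈H _ _)) e
  nonedge : ∀ {i j} → ¬ Edge G i j → ¬ Edge H i j
  nonedge ¬e e = ¬e (trans (G≈H _ _) e)
  Δ-resp : ΔSwitch G G′ → ΔSwitch H G′
  Δ-resp (inj₁ (v , x , y , w , z , distinct , e₁ , e₂ , e₃ , e₄ , ¬e₁ , ¬e₂ , rw)) =
    inj₁ (v , x , y , w , z , distinct , edge e₁ , edge e₂ , edge e₃ , edge e₄ ,
          nonedge ¬e₁ , nonedge ¬e₂ , Rewired-resp {G = G} {H} {G′} G≈H rw)
  Δ-resp (inj₂ (v , x , y , w , z , distinct , e₁ , e₂ , e₃ , e₄ , ¬e₁ , ¬e₂ , rw)) =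
    inj₂ (v , x , y , w , z , distinct , edge e₁ , edge e₂ , edge e₃ , edge e₄ ,
          nonedge ¬e₁ , nonedge ¬e₂ , Rewired-resp {G = G} {H} {G′} G≈H rw)

Reachable-refl : {G H : Graph n} → SameGraph G H → Reachable d G H
Reachable-refl G≈H = _ , ε , G≈H

-- The first path ends in a graph that merely has the adjacency of `H`. Transporting the first step
-- of the second path suffices, since only the source of that step changes.
Reachable-trans : {G H K : Graph n} → Reachable d G H → Reachable d H K → Reachable d G K
Reachable-trans {H = H} {K} (H′ , G⟶H′ , H′≈H) (_ , ε , H≈K) =
  H′ , G⟶H′ , SameGraph-trans {G = H′} {H} {K} H′≈H H≈K
Reachable-trans {H = H} (H′ , G⟶H′ , H′≈H) (K′ , _◅_ {j = J} step steps , K′≈K) =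
  K′ , G⟶H′ ◅◅ (MStep-resp {G = H} {H′} {J} (λ i j → ≡-sym (H′≈H i j)) step ◅ steps) , K′≈K

-- Agreement on the rows of the first vertices.

AgreeBelow : ℕ → Graph n → Graph n → Set
AgreeBelow m G H = ∀ i j → toℕ i < m → adj G i j ≡ adj H i j

AgreeBelow-sym : ∀ {m} {G H : Graph n} → AgreeBelow m G H → AgreeBelow m H G
AgreeBelow-sym G~H i j i<m = ≡-sym (G~H i j i<m)

disagreement : Graph n → Graph n → Fin n → ℕ
disagreement G H v = # (λ j → adj G v j xor adj H v j)

disagreement-sym : ∀ (G H : Graph n) v → disagreement G H v ≡ disagreement H G v
disagreement-sym G H v = #-cong λ j → Bool.xor-comm (adj G v j) (adj H v j)

record Disagree (G H : Graph n) (v a b : Fin n) : Set where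
  field
    va  : adj G v a ≡ true
    va′ : adj H v a ≡ false
    vb  : adj G v b ≡ false
    vb′ : adj H v b ≡ true

Disagree-swap : ∀ {G H : Graph n} {v a b} → Disagree G H v a b → Disagree H G v b a
Disagree-swap dis = record { va = vb′ ; va′ = vb ; vb = va′ ; vb′ = va }
  where open Disagree dis

later : Fin n → Fin n → Bool
later v j = does (toℕ v ≤? toℕ j)

later-≤ : ∀ {v j : Fin n} → later v j ≡ true → toℕ v ≤ toℕ j
later-≤ {v = v} e = ≤ᵇ⇒≤ (toℕ v) _ (subst T (≡-sym e) _)

-- The fourth corner of a switch is taken among the later vertices, in order to keep the rows of smaller
-- vertices; the graph to be switched is the one where the degrees into the later vertices allow this.
laterDegree : Graph n → Fin n → Fin n → ℕ
laterDegree G v x = # (λ j → adj G x j ∧ later v j)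

-- Both degrees of `x` are `d`, and by symmetry the settled rows fix the adjacencies of `x` to
-- earlier vertices.
laterDegree-agree : ∀ {G H : Graph n} v → AgreeBelow (toℕ v) G H → Regular d G → Regular d H →
                    ∀ x → laterDegree G v x ≡ laterDegree H v x
laterDegree-agree {d = d} {G} {H} v G~H regG regH x =
  +-cancelʳ-≡ _ _ _
    (trans (total G regG) (trans (≡-sym (total H regH)) (cong (laterDegree H v x +_) (#-cong earlier))))
  where
  total : ∀ G → Regular d G → laterDegree G v x + # (λ j → adj G x j ∧ not (later v j)) ≡ d
  total G reg = trans (≡-sym (#-split (adj G x) (later v))) (trans (≡-sym (degree≡# G x)) (reg x))
  earlier : ∀ j → adj H x j ∧ not (later v j) ≡ adj G x j ∧ not (later v j)
  earlier j with later v j in v≤j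
  ... | true  = trans (Bool.∧-zeroʳ _) (≡-sym (Bool.∧-zeroʳ _))
  ... | false = cong (_∧ true) (trans (sym H x j) (trans (≡-sym (G~H j x j<v)) (sym G j x)))
    where
    j<v : toℕ j < toℕ v
    j<v = ≰⇒> λ v≤j′ → true≢false (dec-true (_ ≤? _) v≤j′) v≤j

Disagree-later : ∀ {G H : Graph n} {v a b} → AgreeBelow (toℕ v) G H → Disagree G H v a b → toℕ v ≤ toℕ a
Disagree-later {G = G} {H} {v} {a} G~H dis = ≮⇒≥ λ a<v →
  true≢false (trans (sym G a v) va) (trans (G~H a v a<v) (trans (sym H a v) va′))
  where open Disagree dis

-- Among later vertices, `b` has at least as many neighbours as `a`, while `v` is adjacent to `a`
-- only; so some later `c` is adjacent to `b` only.
fourth-corner : ∀ {G H : Graph n} {v a b} → AgreeBelow (toℕ v) G H → Disagree G H v a b →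
                laterDegree G v a ≤ laterDegree G v b →
                ∃ λ c → toℕ v ≤ toℕ c × Alternating G v a b c
fourth-corner {G = G} {H} {v} {a} {b} G~H dis Da≤Db = found (#-exchange {P = P ∖ b} {Q ∖ a} smaller v Pv Qv)
  where
  open Disagree dis
  P Q : Fin _ → Bool
  P j = adj G a j ∧ later v j
  Q j = adj G b j ∧ later v j
  v≢b : v ≢ b
  v≢b refl = true≢false vb′ (irrefl H v)
  later-a : later v a ≡ true
  later-a = dec-true (_ ≤? _) (Disagree-later {G = G} {H} G~H dis)
  later-b : later v b ≡ true
  later-b = dec-true (_ ≤? _) (Disagree-later {G = H} {G} (AgreeBelow-sym {G = G} {H} G~H) (Disagree-swap dis))
  Pb≡Qa : P b ≡ Q a
  Pb≡Qa = cong₂ _∧_ (sym G a b) (trans later-b (≡-sym later-a))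
  -- Excluding `a` from `Q` ensures `c ≢ a`. Excluding `b` from `P` compensates, since both amount
  -- to the same pair `ab`.
  smaller : # (P ∖ b) ≤ # (Q ∖ a)
  smaller = +-cancelʳ-≤ (bit (Q a)) _ _ (begin
    # (P ∖ b) + bit (Q a)  ≡⟨ cong (λ x → # (P ∖ b) + bit x) (≡-sym Pb≡Qa) ⟩
    # (P ∖ b) + bit (P b)  ≡⟨ #-∖ P b ⟩
    # P                    ≤⟨ Da≤Db ⟩
    # Q                    ≡⟨ ≡-sym (#-∖ Q a) ⟩
    # (Q ∖ a) + bit (Q a)  ∎)
    where open ≤-Reasoning
  Pv : (P ∖ b) v ≡ true
  Pv = trans (∖-≢ P v≢b) (cong₂ _∧_ (trans (sym G a v) va) (dec-true (toℕ v ≤? toℕ v) ≤-refl))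
  Qv : (Q ∖ a) v ≡ false
  Qv rewrite sym G b v | vb = refl
  found : (∃ λ c → (Q ∖ a) c ≡ true × (P ∖ b) c ≡ false) →
          ∃ λ c → toℕ v ≤ toℕ c × Alternating G v a b c
  found (c , Qc , Pc) with ∖-⊆ {P = Q} Qc
  ... | Qc′ , c≢a = c , later-≤ v≤c , record
    { p≢r = v≢b
    ; q≢s = c≢a ∘ ≡-sym
    ; pq  = va
    ; rs  = bc
    ; pr  = vb
    ; qs  = begin
        adj G a c              ≡⟨ Bool.∧-identityʳ _ ⟨
        adj G a c ∧ true       ≡⟨ cong (adj G a c ∧_) v≤c ⟨
        P c                    ≡⟨ ∖-≢ P c≢b ⟨
        (P ∖ b) c              ≡⟨ Pc ⟩
        false                  ∎
    }
    where
    open ≡-Reasoning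
    bc : adj G b c ≡ true
    bc = Bool.∧-conicalˡ _ _ Qc′
    v≤c : later v c ≡ true
    v≤c = Bool.∧-conicalʳ (adj G b c) _ Qc′
    c≢b : c ≢ b
    c≢b refl = true≢false bc (irrefl G c)

module _ {G H : Graph n} {v a b c : Fin n} (G~H : AgreeBelow (toℕ v) G H) (dis : Disagree G H v a b)
         (v≤c : toℕ v ≤ toℕ c) (alt : Alternating G v a b c) where

  open Alternating alt using (switch)
  open Corners alt
  open Disagree dis

  -- All four corners are `v` or later, so the earlier rows are untouched.
  switch-agrees : AgreeBelow (toℕ v) switch H
  switch-agrees i j i<v =
    trans (adj-switch-row (apart ≤-refl) (apart (Disagree-later {G = G} {H} G~H dis))
            (apart (Disagree-later {G = H} {G} (AgreeBelow-sym {G = G} {H} G~H) (Disagree-swap dis))) (apart v≤c) j)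
          (G~H i j i<v)
    where
    apart : ∀ {x} → toℕ v ≤ toℕ x → i ≢ x
    apart v≤x refl = <⇒≱ i<v v≤x

  -- In row `v` only the entries `a` and `b` change, and both disagreements disappear; strictness at
  -- `a` is enough.
  switch-improves : disagreement switch H v < disagreement G H v
  switch-improves = #-strict {P = λ j → adj switch v j xor adj H v j} contained a
    (cong₂ _xor_ va-removed va′) (cong₂ _xor_ va va′)
    where
    va-removed : adj switch v a ≡ false
    va-removed = known describes-switch 0<4 1<4 refl
    vb-inserted : adj switch v b ≡ true
    vb-inserted = known describes-switch 0<4 2<4 refl
    contained : ∀ j → adj switch v j xor adj H v j ≡ true → adj G v j xor adj H v j ≡ true
    contained j e = by-cases (j ≟ᶠ a) (j ≟ᶠ b)
      where
      by-cases : Dec (j ≡ a) → Dec (j ≡ b) → adj G v j xor adj H v j ≡ true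
      by-cases (yes refl) _          = contradiction (cong₂ _xor_ va-removed va′) (true≢false e)
      by-cases (no _)     (yes refl) = contradiction (cong₂ _xor_ vb-inserted vb′) (true≢false e)
      by-cases (no j≢a)   (no j≢b)   = trans (cong (_xor adj H v j) (≡-sym (adj-switch-p j≢a j≢b))) e

-- Matching two graphs row by row.

-- Neighbourhoods of equal size coincide unless each contains a vertex outside the other.
row : ∀ {G H : Graph n} → Regular d G → Regular d H → ∀ v →
      (∀ j → adj G v j ≡ adj H v j) ⊎ ∃₂ (Disagree G H v)
row {G = G} {H} regG regH v with any? (λ a → (adj G v a Bool.≟ true) ×-dec (adj H v a Bool.≟ false))
... | yes (a , va , va′) with #-exchange {P = adj G v} {adj H v} (≤-reflexive same-degree) a va va′
  where
  same-degree : # (adj G v) ≡ # (adj H v)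
  same-degree = trans (≡-sym (degree≡# G v)) (trans (regG v) (trans (≡-sym (regH v)) (degree≡# H v)))
...   | b , vb′ , vb = inj₂ (a , b , record { va = va ; va′ = va′ ; vb = vb ; vb′ = vb′ })
row {G = G} {H} regG regH v | no none = inj₁ equal
  where
  same-degree : # (adj H v) ≡ # (adj G v)
  same-degree = trans (≡-sym (degree≡# H v)) (trans (regH v) (trans (≡-sym (regG v)) (degree≡# G v)))
  equal : ∀ j → adj G v j ≡ adj H v j
  equal j with adj G v j in vj | adj H v j in vj′
  ... | true  | true  = refl
  ... | false | false = refl
  ... | true  | false = contradiction (j , vj , vj′) none
  ... | false | true  = contradiction
    (#-exchange {P = adj H v} {adj G v} (≤-reflexive same-degree) j vj′ vj) none

module _ (3≤d : 3 ≤ d) where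

  -- The bound `k` on the disagreements in row `v` is the recursion measure. Either graph may be the
  -- one switched, whence the opposite directions of the two reachabilities.
  match-row : ∀ k {G H : Graph n} v → disagreement G H v ≤ k → AgreeBelow (toℕ v) G H →
    Regular d G → Regular d H →
    ∃₂ λ G′ H′ → AgreeBelow (suc (toℕ v)) G′ H′ × (Regular d G′ × Regular d H′) ×
                 Reachable d G G′ × Reachable d H′ H
  match-row k {G} {H} v D≤k G~H regG regH with row {G = G} {H} regG regH v
  ... | inj₁ equal = G , H , agree , (regG , regH) ,
    Reachable-refl {G = G} {G} (λ _ _ → refl) , Reachable-refl {G = H} {H} (λ _ _ → refl)
    where
    agree : AgreeBelow (suc (toℕ v)) G H
    agree i j i<1+v with i ≟ᶠ v
    ... | yes refl = equal j
    ... | no i≢v   = G~H i j (≤∧≢⇒< (≤-pred i<1+v) (i≢v ∘ toℕ-injective))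
  ... | inj₂ (a , b , dis) with ≤-total (laterDegree G v a) (laterDegree G v b)
  ...   | inj₁ Da≤Db with fourth-corner {G = G} {H} G~H dis Da≤Db
  ...     | c , v≤c , alt = continue k D≤k
    where
    open Alternating alt using (switch; switch-regular)
    continue : ∀ k → disagreement G H v ≤ k → _
    continue zero    D≤0 = contradiction (≤-trans (switch-improves {G = G} {H} G~H dis v≤c alt) D≤0) λ ()
    continue (suc k) D≤k with match-row k {switch} {H} v
      (≤-pred (≤-trans (switch-improves {G = G} {H} G~H dis v≤c alt) D≤k))
      (switch-agrees {G = G} {H} G~H dis v≤c alt) (switch-regular regG) regH
    ... | G′ , H′ , agree , reg , G⟶G′ , H′⟶H = G′ , H′ , agree , reg ,
      Reachable-trans {G = G} {switch} {G′} (Corners.switch-reachable alt regG 3≤d) G⟶G′ , H′⟶H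
  -- The roles of `G`, `H` and of `a`, `b` are exchanged; equality of later degrees carries the
  -- inequality over to `H`.
  match-row k {G} {H} v D≤k G~H regG regH | inj₂ (a , b , dis) | inj₂ Db≤Da
    with fourth-corner {G = H} {G} (AgreeBelow-sym {G = G} {H} G~H) (Disagree-swap dis)
           (≤-trans (≤-reflexive (≡-sym (laterDegree-agree {G = G} {H} v G~H regG regH b)))
           (≤-trans Db≤Da (≤-reflexive (laterDegree-agree {G = G} {H} v G~H regG regH a))))
  ... | c , v≤c , alt = continue k D≤k
    where
    open Alternating alt using (switch; switch-regular)
    H~G = AgreeBelow-sym {G = G} {H} G~H
    improves : disagreement G switch v < disagreement G H v
    improves = ≤-trans (≤-reflexive (cong suc (disagreement-sym G switch v)))
              (≤-trans (switch-improves {G = H} {G} H~G (Disagree-swap dis) v≤c alt)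
                       (≤-reflexive (disagreement-sym H G v)))
    -- The path has to end in `H`, so the switch made in `H` is undone.
    back : Reachable d switch H
    back = Reachable-trans {G = switch} {Alternating.switch (Corners.reversed alt)} {H}
      (Corners.switch-reachable (Corners.reversed alt) (switch-regular regH) 3≤d)
      (Reachable-refl {G = Alternating.switch (Corners.reversed alt)} {H} (Corners.switch-involutive alt))
    continue : ∀ k → disagreement G H v ≤ k → _
    continue zero    D≤0 = contradiction (≤-trans improves D≤0) λ ()
    continue (suc k) D≤k with match-row k {G} {switch} v
      (≤-pred (≤-trans improves D≤k))
      (AgreeBelow-sym {G = switch} {G} (switch-agrees {G = H} {G} H~G (Disagree-swap dis) v≤c alt))
      regG (switch-regular regH)
    ... | G′ , H′ , agree , reg , G⟶G′ , H′⟶H = G′ , H′ , agree , reg , G⟶G′ ,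
      Reachable-trans {G = H′} {switch} {H} H′⟶H back

  -- Here `m` rows are settled and `k` remain; the path runs from `G` to `G′`, then to `H′` by
  -- recursion, then to `H`.
  match-rows : ∀ k m → m + k ≡ n → (G H : Graph n) → AgreeBelow m G H →
               Regular d G → Regular d H → Reachable d G H
  match-rows zero m m+0≡n G H G~H regG regH = Reachable-refl {G = G} {H} λ i j →
    G~H i j (≤-trans (toℕ<n i) (≤-reflexive (trans (≡-sym m+0≡n) (+-identityʳ m))))
  match-rows (suc k) m m+1+k≡n G H G~H regG regH =
    let v = fromℕ< m<n
        G′ , H′ , agree , (regG′ , regH′) , G⟶G′ , H′⟶H =
          -- By `≤-refl` the bound is the disagreement itself.
          match-row _ {G} {H} v ≤-refl (subst (λ m → AgreeBelow m G H) (≡-sym (toℕ-fromℕ< m<n)) G~H) regG regH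
        G′⟶H′ = match-rows k (suc m) (trans (≡-sym (+-suc m k)) m+1+k≡n) G′ H′
          (subst (λ m → AgreeBelow (suc m) G′ H′) (toℕ-fromℕ< m<n) agree) regG′ regH′
    in Reachable-trans {G = G} {G′} {H} G⟶G′ (Reachable-trans {G = G′} {H′} {H} G′⟶H′ H′⟶H)
    where
    m<n : m < _
    m<n = ≤-trans (m≤m+n (suc m) k) (≤-reflexive (trans (≡-sym (+-suc m k)) m+1+k≡n))

theorem1p1 : ∀ (n d : ℕ) → 1 ≤ n → 3 ≤ d → MConnected n d
theorem1p1 n d _ 3≤d G H = match-rows 3≤d n 0 refl G H (λ _ _ ())
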